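{- For every integer $n \geq 3$, $m(n) \leq \frac{(n+1)(n-2)}{2}$, where $m(n)$ is the maximum sort-number (with respect to the map $SC_{231}$) among all permutations in $S_n$.
   Context: Permutations $p \in S_n$ are written in one-line notation as words $p(1)p(2)\cdots p(n)$. A permutation contains a pattern $\sigma\in S_k$ if it has a (not necessarily contiguous) subsequence of $k$ entries in the same relative order as $\sigma$; otherwise it avoids $\sigma$. A sequence of distinct numbers contains $\sigma$ consecutively if some $k$ contiguous entries are in the same relative order as $\sigma$. $\mathrm{Av}_n(132,231)$ is the set of permutations in $S_n$ avoiding both $132$ and $231$ (equivalently, permutations having no index $1<i<n$ with $p(i-1)<p(i)>p(i+1)$). The map $SC_{231}: S_n \to S_n$ is defined by passing $p$ through a stack: the entries of $p$ are the input, read left to right; the stack and output start empty. While the input is nonempty, let $x$ be the next input entry. If, after pushing $x$ on top of the stack, the stack contents read from top to bottom would not contain $231$ consecutively, then push $x$; otherwise pop the top entry of the stack and append it to the right end of the output (and repeat with the same $x$). When the input is empty, pop all remaining stack entries from top to bottom, appending each to the output. The resulting output word is $SC_{231}(p)$. For example $SC_{231}(45231)=13254$ and $SC_{231}(132)=321$. The sort-number of $p \in S_n$ is the minimum integer $k \geq 0$ such that $SC_{231}^k(p) \in \mathrm{Av}_n(132,231)$, where $SC_{231}^k$ is the $k$-fold iterate (such a $k$ exists for every $p$). -}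

module Defs where

open import Data.Bool.Base using (if_then_else_)
open import Data.Fin.Base using (Fin)
open import Data.Fin.Properties using (all?)
open import Data.List.Base using (List; []; _∷_; applyUpTo)
open import Data.List.Relation.Binary.Infix.Heterogeneous using (Infix; here; there)
open import Data.List.Relation.Binary.Permutation.Propositional using (_↭_)
open import Data.List.Relation.Binary.Prefix.Heterogeneous using (Prefix; []; _∷_)
open import Data.List.Relation.Binary.Sublist.Propositional using (_⊆_)
open import Data.Nat.Base using (ℕ; zero; suc; _<_; _≤_)
open import Data.Nat.Properties using (_<?_)
open import Data.Product.Base using (∃-syntax; _×_; _,_)
open import Data.Vec.Base using (Vec; []; _∷_; lookup; toList)
open import Function.Bundles using (_⇔_; mk⇔; Equivalence)
open import Function.Endo.Propositional (List ℕ) using (_^_)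
open import Relation.Binary.PropositionalEquality.Core using (_≡_; refl)
open import Relation.Nullary.Decidable using (Dec; yes; no; does; map′; _×-dec_; _→-dec_)
open import Relation.Nullary.Negation using (¬_; contradiction)

Word : Set
Word = List ℕ

-- A permutation of {1,…,n} is its one-line word, a rearrangement of 1 2 ⋯ n.
_∈S_ : Word → ℕ → Set
p ∈S n = p ↭ applyUpTo suc n

SameOrder : ∀ {k} → Vec ℕ k → Vec ℕ k → Set
SameOrder {k} u v = (i j : Fin k) → (lookup u i < lookup u j) ⇔ (lookup v i < lookup v j)

Contains : ∀ {k} → Vec ℕ k → Word → Set
Contains {k} σ w = ∃[ u ] toList {n = k} u ⊆ w × SameOrder u σ

Avoids : ∀ {k} → Vec ℕ k → Word → Set
Avoids σ w = ¬ Contains σ w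

ContainsConsecutively : ∀ {k} → Vec ℕ k → Word → Set
ContainsConsecutively {k} σ w = ∃[ u ] Infix _≡_ (toList {n = k} u) w × SameOrder u σ

sameOrder? : ∀ {k} (u v : Vec ℕ k) → Dec (SameOrder u v)
sameOrder? u v = all? λ i → all? λ j →
  map′ (λ (f , g) → mk⇔ f g) (λ e → Equivalence.to e , Equivalence.from e)
    (((lookup u i <? lookup u j) →-dec (lookup v i <? lookup v j)) ×-dec
     ((lookup v i <? lookup v j) →-dec (lookup u i <? lookup u j)))

prefix? : ∀ {k} {P : Vec ℕ k → Set} → (∀ u → Dec (P u)) → (w : Word) →
          Dec (∃[ u ] Prefix _≡_ (toList u) w × P u)
prefix? {zero} P? w =
  map′ (λ p → [] , [] , p) (λ { ([] , _ , p) → p }) (P? [])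
prefix? {suc k} P? [] = no λ { (_ ∷ _ , () , _) }
prefix? {suc k} P? (x ∷ w) =
  map′ (λ (u , pre , p) → x ∷ u , refl ∷ pre , p)
       (λ { (_ ∷ u , refl ∷ pre , p) → u , pre , p })
       (prefix? (λ u → P? (x ∷ u)) w)

containsConsecutively? : ∀ {k} (σ : Vec ℕ k) (w : Word) → Dec (ContainsConsecutively σ w)
containsConsecutively? σ w with prefix? (λ u → sameOrder? u σ) w
containsConsecutively? σ w       | yes (u , pre , so) = yes (u , here pre , so)
containsConsecutively? σ []      | no ¬pre =
  no λ { (u , here pre , so) → ¬pre (u , pre , so) }
containsConsecutively? σ (x ∷ w) | no ¬pre =
  map′ (λ (u , inf , so) → u , there inf , so)
       (λ { (u , here pre , so) → contradiction (u , pre , so) ¬pre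
          ; (u , there inf , so) → u , inf , so })
       (containsConsecutively? σ w)

132ₚ 231ₚ : Vec ℕ 3
132ₚ = 1 ∷ 3 ∷ 2 ∷ []
231ₚ = 2 ∷ 3 ∷ 1 ∷ []

-- `pass input stack` is the word still to be output from this state; the head
-- of `stack` is its top.  Pushing onto an empty stack leaves a single entry,
-- which cannot contain 231.
pass : (input stack : Word) → Word
pass []       s       = s
pass (x ∷ xs) []      = pass xs (x ∷ [])
pass (x ∷ xs) (t ∷ s) =
  if does (containsConsecutively? 231ₚ (x ∷ t ∷ s))
  then t ∷ pass (x ∷ xs) s
  else pass xs (x ∷ t ∷ s)

SC₂₃₁ : Word → Word
SC₂₃₁ p = pass p []

_ : SC₂₃₁ (4 ∷ 5 ∷ 2 ∷ 3 ∷ 1 ∷ []) ≡ 1 ∷ 3 ∷ 2 ∷ 5 ∷ 4 ∷ []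
_ = refl

_ : SC₂₃₁ (1 ∷ 3 ∷ 2 ∷ []) ≡ 3 ∷ 2 ∷ 1 ∷ []
_ = refl

-- `p ∈Av n` is p ∈ Avₙ(132,231).
_∈Av_ : Word → ℕ → Set
p ∈Av n = p ∈S n × Avoids 132ₚ p × Avoids 231ₚ p

IsSortNumber : ℕ → Word → ℕ → Set
IsSortNumber n p k = (SC₂₃₁ ^ k) p ∈Av n × (∀ j → j < k → ¬ ((SC₂₃₁ ^ j) p ∈Av n))

-- `IsMaxSortNumber n m` says that m is m(n).  The second component also says
-- that every permutation has a sort-number, so that the maximum is over all of Sₙ.
IsMaxSortNumber : ℕ → ℕ → Set
IsMaxSortNumber n m =
  (∃[ p ] p ∈S n × IsSortNumber n p m) ×
  (∀ p → p ∈S n → ∃[ k ] IsSortNumber n p k × k ≤ m)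

{-# OPTIONS --safe #-}
module Submission where

-- When an entry is blocked, one pop makes room for it, so every popped entry
-- is the "3" of an occurrence of 132, and the entries that are never popped
-- leave in reverse order.  Suppose no v′ < v is the "2" of an occurrence of 132
-- or 231.  Then no entry ≤ v is ever popped, so for the "2"s v′ ≤ v a pass
-- creates no new pair ("2" , "3").  If v is still a "2" after a pass, there is a
-- peak l t r with t > v between v and a smaller entry in the word that the
-- stack delivered.  That word has no consecutive 231, so l < r and the next
-- pass pops t, which then precedes both: v loses the pair (v , t).  As there are
-- n - v candidates for t, v stops being a "2" after n - v + 1 passes; summing
-- over 2 ≤ v < n gives (n + 1)(n - 2)/2.

open import Defs
open import Data.Fin.Base using (zero; suc)
open import Data.List.Base
  using (List; []; _∷_; [_]; _++_; _ʳ++_; map; concatMap; filter; length; applyUpTo)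
open import Data.List.Membership.Propositional using (_∈_; _∉_; find)
open import Data.List.Membership.Propositional.Properties
  using (∈-∃++; ∈-++⁺ʳ; ∈-map⁺; ∈-map⁻; ∈-concatMap⁺; ∈-concatMap⁻; ∈-filter⁺;
         ∈-applyUpTo⁺; ∈-applyUpTo⁻)
open import Data.List.Properties using (filter-notAll; length-applyUpTo; ++-identityʳ)
open import Data.List.Relation.Binary.Infix.Heterogeneous using (Infix; here; there; _++ⁱ_)
open import Data.List.Relation.Binary.Permutation.Propositional
  using (_↭_; ↭-refl; ↭-sym; ↭-trans; ↭-reflexive; prep; swap; ↭⇒↭ₛ)
open import Data.List.Relation.Binary.Permutation.Propositional.Properties
  using (∈-resp-↭; drop-mid; shift; ↭-empty-inv)
import Data.List.Relation.Binary.Permutation.Setoid.Properties as Permutationₛ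
open import Data.List.Relation.Binary.Prefix.Heterogeneous using ([]; _∷_)
open import Data.List.Relation.Binary.Sublist.Propositional
  using (_⊆_; []; _∷_; _∷ʳ_; ⊆-refl; ⊆-trans; lookup; minimum)
open import Data.List.Relation.Binary.Sublist.Propositional.Properties
  using (ʳ++⁺; reverse⁺; ++⁺ˡ; ∷ˡ⁻)
open import Data.List.Relation.Unary.All as All using ([]; _∷_)
open import Data.List.Relation.Unary.Any as Any using (here; there)
open import Data.List.Relation.Unary.Unique.Propositional using (Unique)
open import Data.List.Relation.Unary.Unique.Propositional.Properties using (applyUpTo⁺₁)
open import Data.List.Relation.Unary.AllPairs using (_∷_)
open import Data.Nat.Base using (ℕ; zero; suc; _≤_; _<_; z≤n; s≤s; z<s; s<s; _+_; _*_; _∸_)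
open import Data.Nat.DivMod using (_/_; m*n/n≡m)
open import Data.Nat.Properties
open import Data.Nat.Solver using (module +-*-Solver)
open import Data.Product.Base using (∃-syntax; _×_; _,_; proj₁; proj₂)
open import Data.Sum.Base using (_⊎_; inj₁; inj₂)
open import Data.Vec.Base using (Vec; []; _∷_; toList)
open import Function.Base using (_∘_)
open import Function.Bundles using (mk⇔; Equivalence)
open import Function.Endo.Propositional (List ℕ) using (_^_; ^-homo)
open import Relation.Binary.Definitions using (tri<; tri≈; tri>)
open import Relation.Binary.PropositionalEquality
  using (_≡_; _≢_; refl; sym; trans; cong; cong-app; subst; setoid; module ≡-Reasoning)
open import Relation.Nullary using (¬_; Dec; yes; no; contradiction; ¬?; _×-dec_; _⊎-dec_)
open import Relation.Nullary.Decidable using (map′)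

private variable
  a b c l r t u v w x y : ℕ
  p q s xs ys zs o f : Word

-- Three-letter patterns and runs of the stack.

order231 : c < a → a < b → SameOrder (a ∷ b ∷ c ∷ []) 231ₚ
order231 c<a a<b zero             zero =
  mk⇔ (λ h → contradiction h (<-irrefl refl)) (λ { (s≤s (s≤s ())) })
order231 c<a a<b zero             (suc zero) =
  mk⇔ (λ _ → s<s (s<s z<s)) (λ _ → a<b)
order231 c<a a<b zero             (suc (suc zero)) =
  mk⇔ (λ h → contradiction h (<-asym c<a)) (λ { (s≤s ()) })
order231 c<a a<b (suc zero)       zero =
  mk⇔ (λ h → contradiction h (<-asym a<b)) (λ { (s≤s (s≤s ())) })
order231 c<a a<b (suc zero)       (suc zero) =
  mk⇔ (λ h → contradiction h (<-irrefl refl)) (λ { (s≤s (s≤s (s≤s ()))) })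
order231 c<a a<b (suc zero)       (suc (suc zero)) =
  mk⇔ (λ h → contradiction h (<-asym (<-trans c<a a<b))) (λ { (s≤s ()) })
order231 c<a a<b (suc (suc zero)) zero =
  mk⇔ (λ _ → s<s z<s) (λ _ → c<a)
order231 c<a a<b (suc (suc zero)) (suc zero) =
  mk⇔ (λ _ → s<s z<s) (λ _ → <-trans c<a a<b)
order231 c<a a<b (suc (suc zero)) (suc (suc zero)) =
  mk⇔ (λ h → contradiction h (<-irrefl refl)) (λ { (s≤s ()) })

order231⁻ : SameOrder (a ∷ b ∷ c ∷ []) 231ₚ → c < a × a < b
order231⁻ so = Equivalence.from (so (suc (suc zero)) zero) (s<s z<s)
             , Equivalence.from (so zero (suc zero)) (s<s (s<s z<s))

order132⁻ : SameOrder (a ∷ c ∷ b ∷ []) 132ₚ → a < b × b < c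
order132⁻ so = Equivalence.from (so zero (suc (suc zero))) (s<s z<s)
             , Equivalence.from (so (suc (suc zero)) (suc zero)) (s<s (s<s z<s))

data Blocked (x : ℕ) : Word → Set where
  blocked : a < x → x < t → Blocked x (t ∷ a ∷ s)

-- `Run xs s o f`: reading xs from the stack s pops the word o and leaves the
-- stack f.  After a pop the next entry is pushed at once: x exceeds the new
-- top a, so x and a do not begin a 231.
data Run : (xs s o f : Word) → Set where
  done : Run [] s [] s
  push : ¬ Blocked x s → Run xs (x ∷ s) o f → Run (x ∷ xs) s o f
  pop  : a < x → x < t → Run xs (x ∷ a ∷ s) o f → Run (x ∷ xs) (t ∷ a ∷ s) (t ∷ o) f

blocked⇒231 : Blocked x s → ContainsConsecutively 231ₚ (x ∷ s)
blocked⇒231 (blocked a<x x<t) = _ , here (refl ∷ refl ∷ refl ∷ []) , order231 a<x x<t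

231⇒blocked : ContainsConsecutively 231ₚ (x ∷ s) → ¬ ContainsConsecutively 231ₚ s → Blocked x s
231⇒blocked (_ ∷ _ ∷ _ ∷ [] , here (refl ∷ refl ∷ refl ∷ []) , so) _ =
  let a<x , x<t = order231⁻ so in blocked a<x x<t
231⇒blocked (_ , there i , so) ¬c = contradiction (_ , i , so) ¬c

tail-avoids231 : ¬ ContainsConsecutively 231ₚ (x ∷ s) → ¬ ContainsConsecutively 231ₚ s
tail-avoids231 ¬c (_ , i , so) = ¬c (_ , there i , so)

-- Avoidance of consecutive 231 by the stack is the loop invariant. It passes on to `f`, where it
-- later restricts the shape of peaks.
run : ∀ xs s → ¬ ContainsConsecutively 231ₚ s →
      ∃[ o ] ∃[ f ] Run xs s o f × pass xs s ≡ o ++ f × ¬ ContainsConsecutively 231ₚ f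
run []       s  ¬c = [] , s , done , refl , ¬c
run (x ∷ xs) [] ¬c =
  let o , f , R , eq , ¬c′ = run xs [ x ] λ c → ¬blocked-[] (231⇒blocked c ¬c)
  in o , f , push ¬blocked-[] R , eq , ¬c′
  where
  ¬blocked-[] : ¬ Blocked x []
  ¬blocked-[] ()
run (x ∷ xs) (t ∷ s) ¬c with containsConsecutively? 231ₚ (x ∷ t ∷ s)
... | no ¬xts =
  let o , f , R , eq , ¬c′ = run xs (x ∷ t ∷ s) ¬xts
  in o , f , push (¬xts ∘ blocked⇒231) R , eq , ¬c′
... | yes xts with 231⇒blocked xts ¬c
... | blocked {a} {s = s′} a<x x<t with containsConsecutively? 231ₚ (x ∷ a ∷ s′)
... | yes xas with 231⇒blocked xas (tail-avoids231 ¬c)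
... | blocked _ x<a = contradiction x<a (<-asym a<x)
run (x ∷ xs) (t ∷ s) ¬c | yes xts | blocked {a} {s = s′} a<x x<t | no ¬xas =
  let o , f , R , eq , ¬c′ = run xs (x ∷ a ∷ s′) ¬xas
  in t ∷ o , f , pop a<x x<t R , cong (t ∷_) eq , ¬c′

-- `s ʳ++ xs` is the stack from bottom to top followed by the unread input, so it keeps the input
-- order. There the new top, the popped entry and the blocked entry form a 132.
popped-above : Run xs s o f → t ∈ o → ∃[ a ] ∃[ x ] (a < x) × (x < t) × a ∷ t ∷ x ∷ [] ⊆ s ʳ++ xs
popped-above (push _ R) t∈o = popped-above R t∈o
popped-above (pop {s = s} a<x x<t R) (here refl) =
  _ , _ , a<x , x<t , ʳ++⁺ (minimum s) (refl ∷ refl ∷ refl ∷ minimum _)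
popped-above (pop {s = s} a<x x<t R) (there t∈o) =
  let _ , _ , a<y , y<t , τ = popped-above R t∈o
  in _ , _ , a<y , y<t , ⊆-trans τ (ʳ++⁺ (⊆-refl {x = s}) (refl ∷ _ ∷ʳ ⊆-refl))

-- Pushing leaves `s ʳ++ xs` unchanged, and popping deletes one entry from it.
stack⊆ : Run xs s o f → f ʳ++ [] ⊆ s ʳ++ xs
stack⊆ done = ⊆-refl
stack⊆ (push _ R) = stack⊆ R
stack⊆ (pop {s = s} _ _ R) = ⊆-trans (stack⊆ R) (ʳ++⁺ (⊆-refl {x = s}) (refl ∷ _ ∷ʳ ⊆-refl))

run-↭ : Run xs s o f → o ++ f ↭ xs ++ s
run-↭ done = ↭-refl
run-↭ (push {x = x} {xs = xs} _ R) = ↭-trans (run-↭ R) (shift x xs _)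
run-↭ (pop {x = x} {t = t} {xs = xs} _ _ R) =
  ↭-trans (prep t (↭-trans (run-↭ R) (shift x xs _))) (↭-sym (shift t (x ∷ xs) _))

-- If `t` popped anything it would be `l`, which needs `t < l`. So `t` lands on `l`, and `r` is then
-- blocked and pops `t`.
132-peak-popped-next : Run (t ∷ r ∷ xs) (l ∷ s) o f → l < r → r < t → t ∈ o
132-peak-popped-next (push _ (push ¬b _)) l<r r<t = contradiction (blocked l<r r<t) ¬b
132-peak-popped-next (push _ (pop _ _ _)) l<r r<t = here refl
132-peak-popped-next (pop _ t<l _)        l<r r<t = contradiction t<l (<-asym (<-trans l<r r<t))

132-peak-popped : Run xs s o f → Infix _≡_ (l ∷ t ∷ r ∷ []) xs → l < r → r < t → t ∈ o
132-peak-popped (push _ R)  (there i) l<r r<t = 132-peak-popped R i l<r r<t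
132-peak-popped (pop _ _ R) (there i) l<r r<t = there (132-peak-popped R i l<r r<t)
132-peak-popped (push _ R)  (here (refl ∷ refl ∷ refl ∷ [])) l<r r<t =
  132-peak-popped-next R l<r r<t
132-peak-popped (pop _ _ R) (here (refl ∷ refl ∷ refl ∷ [])) l<r r<t =
  there (132-peak-popped-next R l<r r<t)

run-SC : ∀ p → ∃[ o ] ∃[ f ] Run p [] o f × SC₂₃₁ p ≡ o ++ f × ¬ ContainsConsecutively 231ₚ f
run-SC p = run p [] λ { (_ ∷ _ ∷ _ ∷ [] , here () , _) }

-- Hidden pairs under a pass.

-- v and u play the "2" and the "3" of an occurrence of 132 or 231.
Hidden : Word → ℕ → ℕ → Set
Hidden p v u = ∃[ w ] (w < v) × (v < u) × (w ∷ u ∷ v ∷ [] ⊆ p ⊎ v ∷ u ∷ w ∷ [] ⊆ p)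

Settled : Word → ℕ → Set
Settled p v = ∀ {x u} → x < v → ¬ Hidden p x u

hidden-⊆ : p ⊆ q → Hidden p v u → Hidden q v u
hidden-⊆ σ (w , w<v , v<u , inj₁ τ) = w , w<v , v<u , inj₁ (⊆-trans τ σ)
hidden-⊆ σ (w , w<v , v<u , inj₂ τ) = w , w<v , v<u , inj₂ (⊆-trans τ σ)

hidden-reverse : Hidden s v u → Hidden (s ʳ++ []) v u
hidden-reverse (w , w<v , v<u , inj₁ τ) = w , w<v , v<u , inj₂ (reverse⁺ τ)
hidden-reverse (w , w<v , v<u , inj₂ τ) = w , w<v , v<u , inj₁ (reverse⁺ τ)

hidden-∈ : Hidden p v u → u ∈ p
hidden-∈ (_ , _ , _ , inj₁ τ) = lookup τ (there (here refl))
hidden-∈ (_ , _ , _ , inj₂ τ) = lookup τ (there (here refl))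

-- As `o` precedes `f`, locating the first letter of an occurrence is enough. This matters because
-- its "3" may exceed `v` and be popped.
∷⊆-++⁻ : ∀ o → x ∉ o → x ∷ xs ⊆ o ++ f → x ∷ xs ⊆ f
∷⊆-++⁻ []      x∉o τ          = τ
∷⊆-++⁻ (y ∷ o) x∉o (_ ∷ʳ τ)   = ∷⊆-++⁻ o (x∉o ∘ there) τ
∷⊆-++⁻ (y ∷ o) x∉o (refl ∷ τ) = contradiction (here refl) x∉o

settled⇒not-popped : Settled p v → Run p [] o f → x ≤ v → x ∉ o
settled⇒not-popped settled R x≤v x∈o =
  let _ , y , a<y , y<x , τ = popped-above R x∈o
  in settled (<-≤-trans y<x x≤v) (_ , a<y , y<x , inj₁ τ)

hidden-++⁻ : Settled p v → Run p [] o f → x ≤ v → Hidden (o ++ f) x u → Hidden f x u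
hidden-++⁻ {o = o} settled R x≤v (w , w<x , x<u , inj₁ τ) =
  w , w<x , x<u , inj₁ (∷⊆-++⁻ o (settled⇒not-popped settled R (≤-trans (<⇒≤ w<x) x≤v)) τ)
hidden-++⁻ {o = o} settled R x≤v (w , w<x , x<u , inj₂ τ) =
  w , w<x , x<u , inj₂ (∷⊆-++⁻ o (settled⇒not-popped settled R x≤v) τ)

-- The occurrence lies in `f`, whose reversal is a subsequence of `p`. Reversal exchanges 132 and
-- 231, which is why `Hidden` admits both.
hidden-SC⁻ : Settled p v → x ≤ v → Hidden (SC₂₃₁ p) x u → Hidden p x u
hidden-SC⁻ {p} settled x≤v h with run-SC p
... | o , f , R , eq , _ rewrite eq =
  hidden-⊆ (stack⊆ R) (hidden-reverse (hidden-++⁻ settled R x≤v h))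

settled-SC : Settled p v → Settled (SC₂₃₁ p) v
settled-SC settled x<v h = settled x<v (hidden-SC⁻ settled (<⇒≤ x<v) h)

^-comm : ∀ (g : Word → Word) k x → (g ^ k) (g x) ≡ g ((g ^ k) x)
^-comm g zero    x = refl
^-comm g (suc k) x = cong g (^-comm g k x)

settled-SC^ : ∀ k → Settled p v → Settled ((SC₂₃₁ ^ k) p) v
settled-SC^ zero    settled = settled
settled-SC^ (suc k) settled = settled-SC (settled-SC^ k settled)

hidden-SC^⁻ : ∀ k → Settled p v → Hidden ((SC₂₃₁ ^ k) p) v u → Hidden p v u
hidden-SC^⁻ zero    settled h = h
hidden-SC^⁻ (suc k) settled h = hidden-SC^⁻ k settled (hidden-SC⁻ (settled-SC^ k settled) ≤-refl h)

-- Peaks between two entries.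

Peak : (c b l : ℕ) → Word → Set
Peak c b k xs = ∃[ l ] ∃[ t ] ∃[ r ]
  Infix _≡_ (l ∷ t ∷ r ∷ []) (k ∷ xs) × (l < t) × (r < t) × (c < t) × t ∷ b ∷ [] ⊆ xs

peak-∷ : Peak c b t xs → Peak c b l (t ∷ xs)
peak-∷ (_ , _ , _ , i , l<t , r<t , c<t , τ) = _ , _ , _ , there i , l<t , r<t , c<t , _ ∷ʳ τ

-- Here `l` is the left neighbour of the word. The ascent begun by `l < t` stays above `c ≥ b`, so
-- it cannot climb to `b` and must turn down at `b` or earlier.
climb : l < t → b ≤ c → c < t → Unique (t ∷ xs) → b ∷ [] ⊆ xs → Peak c b l (t ∷ xs)
climb {t = t} {xs = r ∷ xs} l<t b≤c c<t ((t≢r ∷ _) ∷ U) τ with <-cmp t r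
... | tri≈ _ t≡r _ = contradiction t≡r t≢r
... | tri> _ _ r<t = _ , _ , _ , here (refl ∷ refl ∷ refl ∷ []) , l<t , r<t , c<t , refl ∷ τ
climb {xs = r ∷ xs} l<t b≤c c<t (_ ∷ U) (_ ∷ʳ τ)   | tri< t<r _ _ =
  peak-∷ (climb t<r b≤c (<-trans c<t t<r) U τ)
climb {xs = r ∷ xs} l<t b≤c c<t (_ ∷ U) (refl ∷ τ) | tri< t<r _ _ =
  contradiction (<-trans c<t t<r) (≤⇒≯ b≤c)

-- The search is for the first entry above both `c` and its left neighbour. Every skipped entry is
-- below `u`, so `u` itself qualifies if it is reached.
ascend : l < u → b ≤ c → c < u → Unique xs → u ∷ b ∷ [] ⊆ xs → Peak c b l xs
ascend l<u b≤c c<u U (refl ∷ τ) = climb l<u b≤c c<u U τ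
ascend {l = l} {c = c} {xs = t ∷ xs} l<u b≤c c<u U@(_ ∷ U′) (_ ∷ʳ τ) with c <? t | l <? t
... | yes c<t | yes l<t = climb l<t b≤c c<t U (∷ˡ⁻ τ)
... | yes c<t | no  l≮t = peak-∷ (ascend (≤-<-trans (≮⇒≥ l≮t) l<u) b≤c c<u U′ τ)
... | no  c≮t | _       = peak-∷ (ascend (≤-<-trans (≮⇒≥ c≮t) c<u) b≤c c<u U′ τ)

peak-between : a < u → b ≤ c → c < u → Unique xs → a ∷ u ∷ b ∷ [] ⊆ xs →
               ∃[ l ] ∃[ t ] ∃[ r ] Infix _≡_ (l ∷ t ∷ r ∷ []) xs ×
                 (l < t) × (r < t) × (c < t) × a ∷ t ∷ b ∷ [] ⊆ xs
peak-between a<u b≤c c<u (_ ∷ U) (_ ∷ʳ τ) =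
  let _ , _ , _ , i , l<t , r<t , c<t , σ = peak-between a<u b≤c c<u U τ
  in _ , _ , _ , there i , l<t , r<t , c<t , _ ∷ʳ σ
peak-between a<u b≤c c<u (_ ∷ U) (refl ∷ τ) =
  let _ , _ , _ , i , l<t , r<t , c<t , σ = ascend a<u b≤c c<u U τ
  in _ , _ , _ , i , l<t , r<t , c<t , refl ∷ σ

-- The threshold `c` is `v` in both cases, the right end being `v` or the smaller `w`. Hence the top
-- of the peak again forms a hidden pair with `v`.
hidden-peak : Unique p → Hidden p v u →
              ∃[ l ] ∃[ t ] ∃[ r ] Infix _≡_ (l ∷ t ∷ r ∷ []) p × (l < t) × (r < t) × Hidden p v t
hidden-peak U (w , w<v , v<u , inj₁ τ) =
  let _ , _ , _ , i , l<t , r<t , v<t , σ = peak-between (<-trans w<v v<u) ≤-refl v<u U τ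
  in _ , _ , _ , i , l<t , r<t , w , w<v , v<t , inj₁ σ
hidden-peak U (w , w<v , v<u , inj₂ τ) =
  let _ , _ , _ , i , l<t , r<t , v<t , σ = peak-between v<u (<⇒≤ w<v) v<u U τ
  in _ , _ , _ , i , l<t , r<t , w , w<v , v<t , inj₂ σ

infix-ends-≢ : Unique p → Infix _≡_ (l ∷ t ∷ r ∷ []) p → l ≢ r
infix-ends-≢ (_ ∷ U) (there i) = infix-ends-≢ U i
infix-ends-≢ ((_ ∷ l≢r ∷ _) ∷ _) (here (refl ∷ refl ∷ refl ∷ [])) = l≢r

avoiding-peak-popped : Unique f → ¬ ContainsConsecutively 231ₚ f →
                       Infix _≡_ (l ∷ t ∷ r ∷ []) f → l < t → r < t →
                       Run (q ++ f) [] o s → t ∈ o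
avoiding-peak-popped {l = l} {r = r} {q = q} U ¬c i l<t r<t R with <-cmp l r
... | tri< l<r _ _ = 132-peak-popped R (q ++ⁱ i) l<r r<t
... | tri≈ _ l≡r _ = contradiction l≡r (infix-ends-≢ U i)
... | tri> _ _ r<l = contradiction (_ , i , order231 r<l l<t) ¬c

unique-++⁻ʳ : ∀ o → Unique (o ++ f) → Unique f
unique-++⁻ʳ []      U       = U
unique-++⁻ʳ (_ ∷ o) (_ ∷ U) = unique-++⁻ʳ o U

unique-++⁻-disjoint : Unique (o ++ f) → x ∈ o → x ∉ f
unique-++⁻-disjoint (x≢ ∷ _) (here refl) x∈f = All.lookup x≢ (∈-++⁺ʳ _ x∈f) refl
unique-++⁻-disjoint (_ ∷ U)  (there x∈o) x∈f = unique-++⁻-disjoint U x∈o x∈f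

-- The peak is found in the final stack `f` of the pass over `q`, and the next pass pops its top `t`
-- into `o′`. If the pair survived, `t` would also lie in `f′`, against uniqueness.
some-pair-exposed : Settled q v → Unique (SC₂₃₁ q) → Unique (SC₂₃₁ (SC₂₃₁ q)) →
                    Hidden (SC₂₃₁ q) v u →
                    ∃[ t ] Hidden (SC₂₃₁ q) v t × ¬ Hidden (SC₂₃₁ (SC₂₃₁ q)) v t
some-pair-exposed {q} {v} settled U U′ h with run-SC q | run-SC (SC₂₃₁ q)
... | o , f , R , eq , ¬c | o′ , f′ , R′ , eq′ , _
  with hidden-peak (unique-++⁻ʳ o (subst Unique eq U))
         (hidden-++⁻ settled R ≤-refl (subst (λ p → Hidden p v _) eq h))
... | l , t , r , i , l<t , r<t , ht =
  t , subst (λ p → Hidden p v t) (sym eq) (hidden-⊆ (++⁺ˡ o ⊆-refl) ht) , λ h′ →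
    unique-++⁻-disjoint (subst Unique eq′ U′)
      (avoiding-peak-popped {q = o} (unique-++⁻ʳ o (subst Unique eq U)) ¬c i l<t r<t
        (subst (λ p → Run p [] o′ f′) eq R′))
      (hidden-∈ (hidden-++⁻ (settled-SC settled) R′ ≤-refl (subst (λ p → Hidden p v t) eq′ h′)))

-- Counting the passes.

∈S⇒unique : ∀ {n} → p ∈S n → Unique p
∈S⇒unique {n = n} π = Permutationₛ.Unique-resp-↭ (setoid ℕ) (↭⇒↭ₛ (↭-sym π))
  (applyUpTo⁺₁ suc n λ i<j _ eq → <⇒≢ i<j (suc-injective eq))

∈S-bounds : ∀ {n} → p ∈S n → x ∈ p → 0 < x × x ≤ n
∈S-bounds π x∈p with ∈-applyUpTo⁻ suc (∈-resp-↭ π x∈p)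
... | i , i<n , refl = z<s , i<n

SC-∈S : ∀ {n} → p ∈S n → SC₂₃₁ p ∈S n
SC-∈S {p} π with run-SC p
... | o , f , R , eq , _ =
  ↭-trans (↭-reflexive eq) (↭-trans (run-↭ R) (↭-trans (↭-reflexive (++-identityʳ p)) π))

SC^-∈S : ∀ {n} k → p ∈S n → (SC₂₃₁ ^ k) p ∈S n
SC^-∈S zero    π = π
SC^-∈S (suc k) π = SC-∈S (SC^-∈S k π)

-- The first pass only brings v and the smaller entries onto the final stack;
-- from then on each pass removes a candidate from us.
hidden-exhausted : ∀ {n} m (us : List ℕ) → length us ≤ m → q ∈S n → Settled q v →
                   (∀ {u} → Hidden (SC₂₃₁ q) v u → u ∈ us) →
                   ¬ Hidden ((SC₂₃₁ ^ m) (SC₂₃₁ q)) v u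
hidden-exhausted zero [] _ π settled ⊆us h with ⊆us h
... | ()
hidden-exhausted {q} (suc m) us ≤m π settled ⊆us h
  with some-pair-exposed settled (∈S⇒unique (SC-∈S π)) (∈S⇒unique (SC-∈S (SC-∈S π)))
         (hidden-SC^⁻ (suc m) (settled-SC settled) h)
... | t , ht , ¬ht =
  hidden-exhausted m (filter (λ u → ¬? (u ≟ t)) us)
    (≤-pred (≤-trans (filter-notAll _ us (Any.map (λ { refl t≢t → t≢t refl }) (⊆us ht))) ≤m))
    (SC-∈S π) (settled-SC settled)
    (λ h′ → ∈-filter⁺ _ (⊆us (hidden-SC⁻ (settled-SC settled) ≤-refl h′))
                  (λ { refl → ¬ht h′ }))
    (subst (λ p → Hidden p _ _) (sym (^-comm SC₂₃₁ m (SC₂₃₁ q))) h)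

settled-suc : Settled p v → (∀ {u} → ¬ Hidden p v u) → Settled p (suc v)
settled-suc settled ¬h {x} x<1+v h with m≤n⇒m<n∨m≡n (≤-pred x<1+v)
... | inj₁ x<v  = settled x<v h
... | inj₂ refl = ¬h h

phase : ∀ {n} d → v + d ≡ n → p ∈S n → Settled p v → Settled ((SC₂₃₁ ^ suc d) p) (suc v)
phase {v} {p} d refl π settled = settled-suc (settled-SC^ (suc d) settled) λ h →
  -- The `d` candidates v + 1, ..., n account for `d` passes, on top of the initial one.
  hidden-exhausted d (applyUpTo (λ i → suc v + i) d) (≤-reflexive (length-applyUpTo _ d)) π settled
    candidate (subst (λ p → Hidden p v _) (sym (^-comm SC₂₃₁ d p)) h)
  where
  candidate : Hidden (SC₂₃₁ p) v u → u ∈ applyUpTo (λ i → suc v + i) d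
  candidate {u} h@(_ , _ , v<u , _) = subst (_∈ applyUpTo (λ i → suc v + i) d) (m+[n∸m]≡n v<u)
    (∈-applyUpTo⁺ _ (+-cancelˡ-< (suc v) (u ∸ suc v) d
      (subst (_< suc v + d) (sym (m+[n∸m]≡n v<u)) (s≤s (proj₂ (∈S-bounds (SC-∈S π) (hidden-∈ h)))))))

-- The phase of v, with d = n - v, takes d + 1 passes.
steps : ℕ → ℕ
steps zero    = 0
steps (suc d) = steps d + suc (suc d)

phases : ∀ {n} d → v + d ≡ n → p ∈S n → Settled p v → Settled ((SC₂₃₁ ^ steps d) p) n
-- The value n gets no phase: nothing exceeds it, so it is never a "2".
phases {v} {p} zero eq π settled =
  subst (Settled p) (trans (sym (+-identityʳ v)) eq) settled
phases {v} {p} {n} (suc d) eq π settled =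
  subst (λ q → Settled q n) (sym (cong-app (^-homo SC₂₃₁ (steps d) (suc (suc d))) p))
    (phases d (trans (sym (+-suc v d)) eq) (SC^-∈S (suc (suc d)) π) (phase (suc d) eq π settled))

-- No entry is smaller than 1, so 1 is never a "2". The phases can thus start at 2, which makes `d`
-- equal to n - 2.
settled-2 : ∀ {n} → p ∈S n → Settled p 2
settled-2 π {zero}        x<2 (_ , () , _)
settled-2 π {suc zero}    x<2 (zero , _ , _ , inj₁ τ) =
  contradiction (proj₁ (∈S-bounds π (lookup τ (here refl)))) λ ()
settled-2 π {suc zero}    x<2 (zero , _ , _ , inj₂ τ) =
  contradiction (proj₁ (∈S-bounds π (lookup τ (there (there (here refl)))))) λ ()
settled-2 π {suc zero}    x<2 (suc _ , s≤s () , _)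
settled-2 π {suc (suc _)} (s≤s (s≤s ())) _

-- A "2" lies below its "3", which is at most `n`, so `Settled p n` covers every possible "2".
settled⇒∈Av : ∀ {n} → p ∈S n → Settled p n → p ∈Av n
settled⇒∈Av π settled = π , avoids132 , avoids231
  where
  avoids132 : Avoids 132ₚ _
  avoids132 (_ ∷ _ ∷ _ ∷ [] , τ , so) =
    let a<b , b<c = order132⁻ so
    in settled (<-≤-trans b<c (proj₂ (∈S-bounds π (lookup τ (there (here refl))))))
         (_ , a<b , b<c , inj₁ τ)
  avoids231 : Avoids 231ₚ _
  avoids231 (_ ∷ _ ∷ _ ∷ [] , τ , so) =
    let c<a , a<b = order231⁻ so
    in settled (<-≤-trans a<b (proj₂ (∈S-bounds π (lookup τ (there (here refl))))))
         (_ , c<a , a<b , inj₂ τ)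

-- Least sort-numbers and their maximum.

subword? : ∀ {k} {P : Vec ℕ k → Set} → (∀ u → Dec (P u)) → (w : Word) →
           Dec (∃[ u ] toList u ⊆ w × P u)
subword? {zero} P? w =
  map′ (λ h → [] , minimum w , h) (λ { ([] , _ , h) → h }) (P? [])
subword? {suc k} P? [] = no λ { (_ ∷ _ , () , _) }
subword? {suc k} P? (x ∷ w) =
  map′ (λ { (inj₁ (u , τ , h)) → x ∷ u , refl ∷ τ , h
          ; (inj₂ (u , τ , h)) → u , x ∷ʳ τ , h })
       (λ { (_ ∷ u , refl ∷ τ , h) → inj₁ (u , τ , h)
          ; (u , (_ ∷ʳ τ) , h)       → inj₂ (u , τ , h) })
       (subword? (λ u → P? (x ∷ u)) w ⊎-dec subword? P? w)

avoids? : ∀ {k} (σ : Vec ℕ k) w → Dec (Avoids σ w)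
avoids? σ w = ¬? (subword? (λ u → sameOrder? u σ) w)

∈Av? : ∀ {n} → p ∈S n → Dec (p ∈Av n)
∈Av? {p} π = map′ (π ,_) proj₂ (avoids? 132ₚ p ×-dec avoids? 231ₚ p)

-- Decidability makes the minimum constructive, and the known solution `m` bounds the search.
least : ∀ {P : ℕ → Set} → (∀ k → Dec (P k)) → ∀ m → P m →
        ∃[ k ] (P k × (∀ j → j < k → ¬ P j)) × k ≤ m
least P? m pm with P? 0
... | yes p0 = 0 , (p0 , λ _ ()) , z≤n
least P? zero    pm | no ¬p0 = contradiction pm ¬p0
least P? (suc m) pm | no ¬p0 =
  let k , (pk , min) , k≤m = least (P? ∘ suc) m pm
  in suc k , (pk , λ { zero _ → ¬p0 ; (suc j) (s≤s j<k) → min j j<k }) , s≤s k≤m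

sortNumber≤ : ∀ d → p ∈S (2 + d) → ∃[ k ] IsSortNumber (2 + d) p k × k ≤ steps d
sortNumber≤ d π =
  least (λ k → ∈Av? (SC^-∈S k π)) (steps d)
    (settled⇒∈Av (SC^-∈S (steps d) π) (phases d refl π (settled-2 π)))

insertions : ℕ → Word → List Word
insertions x []       = [ [ x ] ]
insertions x (y ∷ ys) = (x ∷ y ∷ ys) ∷ map (y ∷_) (insertions x ys)

-- An attained maximum over all of Sₙ is extracted from an explicit finite list.
permutations : Word → List Word
permutations []       = [ [] ]
permutations (x ∷ xs) = concatMap (insertions x) (permutations xs)

∈-insertions⁺ : ∀ ys → ys ++ x ∷ zs ∈ insertions x (ys ++ zs)
∈-insertions⁺ {zs = []}    []       = here refl
∈-insertions⁺ {zs = _ ∷ _} []       = here refl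
∈-insertions⁺              (y ∷ ys) = there (∈-map⁺ (y ∷_) (∈-insertions⁺ ys))

∈-insertions⁻ : ∀ ys → p ∈ insertions x ys → p ↭ x ∷ ys
∈-insertions⁻ []       (here refl) = ↭-refl
∈-insertions⁻ (y ∷ ys) (here refl) = ↭-refl
∈-insertions⁻ (y ∷ ys) (there p∈) with ∈-map⁻ (y ∷_) p∈
... | _ , q∈ , refl = ↭-trans (prep y (∈-insertions⁻ ys q∈)) (swap y _ ↭-refl)

∈-permutations⁺ : ∀ xs → p ↭ xs → p ∈ permutations xs
∈-permutations⁺ []       π with ↭-empty-inv π
... | refl = here refl
∈-permutations⁺ (x ∷ xs) π with ∈-∃++ (∈-resp-↭ (↭-sym π) (here refl))
... | ys , zs , refl = ∈-concatMap⁺ (insertions x)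
  (Any.map (λ { refl → ∈-insertions⁺ ys }) (∈-permutations⁺ xs (drop-mid ys [] π)))

∈-permutations⁻ : ∀ xs → p ∈ permutations xs → p ↭ xs
∈-permutations⁻ []       (here refl) = ↭-refl
∈-permutations⁻ (x ∷ xs) p∈
  with find (∈-concatMap⁻ (insertions x) {xs = permutations xs} p∈)
... | q , q∈ , p∈ins = ↭-trans (∈-insertions⁻ q p∈ins) (prep x (∈-permutations⁻ xs q∈))

maximum : ∀ {Q : Word → ℕ → Set} {b} x xs → (∀ {p} → p ∈ x ∷ xs → ∃[ k ] Q p k × k ≤ b) →
          ∃[ m ] (∃[ p ] p ∈ x ∷ xs × Q p m) ×
                 (∀ {p} → p ∈ x ∷ xs → ∃[ k ] Q p k × k ≤ m) × m ≤ b
maximum x [] Q∃ =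
  let k , qk , k≤b = Q∃ (here refl)
  in k , (x , here refl , qk) , (λ { (here refl) → k , qk , ≤-refl }) , k≤b
maximum x (y ∷ ys) Q∃ with Q∃ (here refl) | maximum y ys (Q∃ ∘ there)
... | k , qk , k≤b | m , (p , p∈ , qm) , ≤m , m≤b with ≤-total k m
... | inj₁ k≤m = m , (p , there p∈ , qm)
               , (λ { (here refl) → k , qk , k≤m ; (there q∈) → ≤m q∈ }) , m≤b
... | inj₂ m≤k = k , (x , here refl , qk)
               , (λ { (here refl) → k , qk , ≤-refl
                    ; (there q∈) → let j , qj , j≤m = ≤m q∈ in j , qj , ≤-trans j≤m m≤k }) , k≤b

-- Doubling avoids division in the induction. The right side is `(n + 1) * (n ∸ 2)` at n = 2 + d.
steps-closed : ∀ d → steps d * 2 ≡ (2 + d + 1) * d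
steps-closed zero    = refl
steps-closed (suc d) = begin
  (steps d + suc (suc d)) * 2       ≡⟨ *-distribʳ-+ 2 (steps d) _ ⟩
  steps d * 2 + suc (suc d) * 2     ≡⟨ cong (_+ suc (suc d) * 2) (steps-closed d) ⟩
  (2 + d + 1) * d + suc (suc d) * 2 ≡⟨ solve 1 (λ d → (con 2 :+ d :+ con 1) :* d :+ (con 2 :+ d) :* con 2
                                         := (con 2 :+ (con 1 :+ d) :+ con 1) :* (con 1 :+ d)) refl d ⟩
  (2 + suc d + 1) * suc d           ∎
  where open ≡-Reasoning; open +-*-Solver

theorem4p3 : ∀ (n : ℕ) → 3 ≤ n → ∃[ m ] IsMaxSortNumber n m × m ≤ ((n + 1) * (n ∸ 2)) / 2
theorem4p3 (suc (suc d)) _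
  -- The list is generalised together with its membership facts so that it can be split; the
  -- identity permutation refutes the empty case.
  with permutations (applyUpTo suc (2 + d))
     | ∈-permutations⁺ {p = applyUpTo suc (2 + d)} _ ↭-refl
     | (λ {p} → ∈-permutations⁺ {p = p} (applyUpTo suc (2 + d)))
     | (λ {p} → ∈-permutations⁻ {p = p} (applyUpTo suc (2 + d)))
... | []     | () | _ | _
... | x ∷ xs | _ | complete | sound =
  let m , (p , p∈ , pm) , ≤m , m≤steps = maximum x xs (sortNumber≤ d ∘ sound)
  in m , ((p , sound p∈ , pm) , λ _ π → ≤m (complete π))
   , ≤-trans m≤steps (≤-reflexive (trans (sym (m*n/n≡m (steps d) 2)) (cong (_/ 2) (steps-closed d))))
theorem4p3 (suc zero) (s≤s ())
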